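{- Let $\alpha\geq 2$ be any ordinal, let $X$ be any set, and let $\mathfrak{Fr}_X\mathsf{Drs}_\alpha$ be the free algebra of $\mathsf{Drs}_\alpha$ freely generated by $X$. Then: (i) if $X=\emptyset$, then $\mathfrak{Fr}_X\mathsf{Drs}_{\alpha}$ is a two-element algebra, hence it is atomic; (ii) if $X\neq\emptyset$, then $\mathfrak{Fr}_X\mathsf{Drs}_{\alpha}$ is atomless.
   Context: For sequences $f,g$ of length $\alpha$ and $i\in\alpha$, write $f\equiv_i g$ iff $f(j)=g(j)$ for all $j\in\alpha\setminus\{i\}$. For a set $V$ of sequences of length $\alpha$, $i\in\alpha$ and $Y\subseteq V$, put $C_i^{[V]}Y=\{f\in V:(\exists g\in Y)\ f\equiv_i g\}$. Let $\mathfrak{P}(V)=\langle \mathcal{P}(V),\cap,\cup,\setminus,\emptyset,V,C_i^{[V]}\rangle_{i\in\alpha}$, where $\setminus$ is complementation relative to $V$; it is an algebra in the signature $\cdot,+,-,0,1,c_i$ $(i\in\alpha)$. $\mathsf{Drs}_\alpha$ is the class of all isomorphic copies of subalgebras of algebras $\mathfrak{P}(V)$ with $\emptyset\neq V\subseteq{}^{\alpha}U$ for some set $U$. The free algebra $\mathfrak{Fr}_X\mathsf{Drs}_\alpha$ is the algebra of all terms in this signature with variables from $X$, modulo the congruence identifying terms $s,t$ iff the equation $s=t$ is valid in $\mathsf{Drs}_\alpha$. Atoms refer to the Boolean reduct: an atom is a minimal non-zero element; an algebra is atomic if below every non-zero element there is an atom, and atomless if it has no atoms. -}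

module Defs where

open import Level using (Level; _⊔_; suc; 0ℓ)
open import Data.Fin as Fin using (Fin)
import Data.Fin.Properties as Fin
import Data.Fin.Induction as Fin
open import Data.Nat using (ℕ)
open import Data.Product using (Σ; ∃; _×_; _,_; proj₁; proj₂)
import Data.Sum as Sum
open import Data.Empty.Polymorphic using (⊥)
open import Function.Base using (id; _∘_; _on_)
open import Function.Bundles using (Bijection)
open import Function.Definitions using (Congruent; Bijective)
open import Induction.WellFounded using (WellFounded)
open import Relation.Binary
  using (Rel; Setoid; IsEquivalence; IsStrictTotalOrder; _Respects_)
import Relation.Binary.Construct.On as On
open import Relation.Binary.PropositionalEquality
  using (_≡_; _≢_; _≗_; refl; sym; trans; setoid)
open import Relation.Nullary using (¬_)
open import Relation.Unary using (Pred; _∈_; _⊆_; _∩_; _∪_; _∖_; _≐_; Empty)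

private
  variable
    a b ℓ i c c₁ c₂ e e₁ e₂ p : Level

-- Ordinals are represented by well-ordered types; `2 ≤ α` and the like are
-- expressed by embeddings onto initial segments.

record Ordinal ℓ : Set (suc ℓ) where
  field
    Index              : Set ℓ
    _<_                : Rel Index ℓ
    isStrictTotalOrder : IsStrictTotalOrder _≡_ _<_
    wellFounded        : WellFounded _<_

finite : ℕ → Ordinal 0ℓ
finite n = record
  { Index              = Fin n
  ; _<_                = Fin._<_
  ; isStrictTotalOrder = Fin.<-isStrictTotalOrder
  ; wellFounded        = Fin.<-wellFounded
  }

infix 4 _≤ₒ_
_≤ₒ_ : Ordinal a → Ordinal b → Set (a ⊔ b)
α ≤ₒ β = Σ (α.Index → β.Index) λ f →
    (∀ {x y} → x α.< y → f x β.< f y)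
  × (∀ {x z} → z β.< f x → ∃ λ y → y α.< x × f y ≡ z)
  where
  module α = Ordinal α
  module β = Ordinal β

-- Algebras in the signature ·, +, -, 0, 1, cᵢ (i ∈ I); no laws are imposed.

record Algebra (I : Set i) c e : Set (i ⊔ suc (c ⊔ e)) where
  infix  4 _≈_
  infixr 7 _·_
  infixr 6 _+_
  infix  8 -_
  field
    Carrier       : Set c
    _≈_           : Rel Carrier e
    _·_ _+_       : Carrier → Carrier → Carrier
    -_            : Carrier → Carrier
    0# 1#         : Carrier
    cyl           : I → Carrier → Carrier
    isEquivalence : IsEquivalence _≈_
    ·-cong        : ∀ {x x′ y y′} → x ≈ x′ → y ≈ y′ → x · y ≈ x′ · y′
    +-cong        : ∀ {x x′ y y′} → x ≈ x′ → y ≈ y′ → x + y ≈ x′ + y′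
    -‿cong        : ∀ {x x′} → x ≈ x′ → - x ≈ - x′
    cyl-cong      : ∀ k {x x′} → x ≈ x′ → cyl k x ≈ cyl k x′

  open IsEquivalence isEquivalence public
    using () renaming (refl to ≈-refl; sym to ≈-sym; trans to ≈-trans)

  carrierSetoid : Setoid c e
  carrierSetoid = record { isEquivalence = isEquivalence }

  infix 4 _≤_
  _≤_ : Rel Carrier e
  x ≤ y = x · y ≈ x

  Atom : Pred Carrier (c ⊔ e)
  Atom x = ¬ x ≈ 0# × (∀ y → ¬ y ≈ 0# → y ≤ x → y ≈ x)

module _ {I : Set i} (A : Algebra I c e) where
  open Algebra A

  Atomic : Set (c ⊔ e)
  Atomic = ∀ x → ¬ x ≈ 0# → ∃ λ y → Atom y × y ≤ x

  Atomless : Set (c ⊔ e)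
  Atomless = Empty Atom

  TwoElement : Set (c ⊔ e)
  TwoElement = Bijection (setoid (Fin 2)) carrierSetoid

  record Subuniverse p : Set (i ⊔ c ⊔ e ⊔ suc p) where
    field
      Member     : Pred Carrier p
      respects   : Member Respects _≈_
      ·-closed   : ∀ {x y} → x ∈ Member → y ∈ Member → x · y ∈ Member
      +-closed   : ∀ {x y} → x ∈ Member → y ∈ Member → x + y ∈ Member
      -‿closed   : ∀ {x} → x ∈ Member → - x ∈ Member
      0-closed   : 0# ∈ Member
      1-closed   : 1# ∈ Member
      cyl-closed : ∀ k {x} → x ∈ Member → cyl k x ∈ Member

subalgebra : {I : Set i} (A : Algebra I c e) → Subuniverse A p →
             Algebra I (c ⊔ p) e
subalgebra A S = record
  { Carrier       = ∃ Member
  ; _≈_           = _≈_ on proj₁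
  ; _·_           = λ (x , x∈) (y , y∈) → x · y , ·-closed x∈ y∈
  ; _+_           = λ (x , x∈) (y , y∈) → x + y , +-closed x∈ y∈
  ; -_            = λ (x , x∈) → - x , -‿closed x∈
  ; 0#            = 0# , 0-closed
  ; 1#            = 1# , 1-closed
  ; cyl           = λ k (x , x∈) → cyl k x , cyl-closed k x∈
  ; isEquivalence = On.isEquivalence proj₁ isEquivalence
  ; ·-cong        = ·-cong
  ; +-cong        = +-cong
  ; -‿cong        = -‿cong
  ; cyl-cong      = λ k → cyl-cong k
  }
  where
  open Algebra A
  open Subuniverse S

record _≅_ {I : Set i} (A : Algebra I c₁ e₁) (B : Algebra I c₂ e₂) :
           Set (i ⊔ c₁ ⊔ c₂ ⊔ e₁ ⊔ e₂) where
  private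
    module A = Algebra A
    module B = Algebra B
  field
    to        : A.Carrier → B.Carrier
    cong      : Congruent A._≈_ B._≈_ to
    bijective : Bijective A._≈_ B._≈_ to
    ·-homo    : ∀ x y → to (x A.· y) B.≈ to x B.· to y
    +-homo    : ∀ x y → to (x A.+ y) B.≈ to x B.+ to y
    -‿homo    : ∀ x → to (A.- x) B.≈ B.- to x
    0-homo    : to A.0# B.≈ B.0#
    1-homo    : to A.1# B.≈ B.1#
    cyl-homo  : ∀ k x → to (A.cyl k x) B.≈ B.cyl k (to x)

-- Sequences are functions I → U.  Function extensionality is not available,
-- so sets of sequences are predicates respecting pointwise equality _≗_.

module _ {I U : Set ℓ} where

  infix 4 _≡[_]_
  _≡[_]_ : (I → U) → I → (I → U) → Set ℓ
  f ≡[ k ] g = ∀ j → j ≢ k → f j ≡ g j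

  C[_] : Pred (I → U) ℓ → I → Pred (I → U) ℓ → Pred (I → U) ℓ
  C[ V ] k Y f = f ∈ V × ∃ λ g → g ∈ Y × f ≡[ k ] g

  record Subset (V : Pred (I → U) ℓ) : Set (suc ℓ) where
    field
      set      : Pred (I → U) ℓ
      respects : set Respects _≗_
      within   : set ⊆ V

  open Subset

  -- The argument `ext` says that V itself is a set of sequences in the above
  -- sense.
  𝔓 : (V : Pred (I → U) ℓ) (ext : V Respects _≗_) → Algebra I (suc ℓ) ℓ
  𝔓 V ext = record
    { Carrier       = Subset V
    ; _≈_           = _≐_ on set
    ; _·_           = λ Y Z → record
      { set      = set Y ∩ set Z
      ; respects = λ f≗g (f∈Y , f∈Z) → respects Y f≗g f∈Y , respects Z f≗g f∈Z
      ; within   = within Y ∘ proj₁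
      }
    ; _+_           = λ Y Z → record
      { set      = set Y ∪ set Z
      ; respects = λ f≗g → Sum.map (respects Y f≗g) (respects Z f≗g)
      ; within   = Sum.[ within Y , within Z ]
      }
    ; -_            = λ Y → record
      { set      = V ∖ set Y
      ; respects = λ f≗g (f∈V , f∉Y) →
          ext f≗g f∈V , f∉Y ∘ respects Y (sym ∘ f≗g)
      ; within   = proj₁
      }
    ; 0#            = record
      { set      = λ _ → ⊥
      ; respects = λ _ ()
      ; within   = λ ()
      }
    ; 1#            = record { set = V ; respects = ext ; within = id }
    ; cyl           = λ k Y → record
      { set      = C[ V ] k (set Y)
      ; respects = λ f≗g (f∈V , h , h∈Y , f≡h) →
          ext f≗g f∈V , h , h∈Y , λ j j≢k → trans (sym (f≗g j)) (f≡h j j≢k)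
      ; within   = proj₁
      }
    ; isEquivalence = record
      { refl  = id , id
      ; sym   = λ (p , q) → q , p
      ; trans = λ (p , q) (r , s) → r ∘ p , q ∘ s
      }
    ; ·-cong        = λ (p , q) (r , s) →
        (λ (y , z) → p y , r z) , (λ (y , z) → q y , s z)
    ; +-cong        = λ (p , q) (r , s) → Sum.map p r , Sum.map q s
    ; -‿cong        = λ (p , q) →
        (λ (v , n) → v , n ∘ q) , (λ (v , n) → v , n ∘ p)
    ; cyl-cong      = λ _ (p , q) →
        (λ (v , g , y , eq) → v , g , p y , eq) ,
        (λ (v , g , y , eq) → v , g , q y , eq)
    }

module _ (α : Ordinal ℓ) where
  open Ordinal α using (Index)

  -- Power sets of sets in Set ℓ have carrier in Set (suc ℓ) and equality
  -- in Set ℓ.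
  record Drs (A : Algebra Index (suc ℓ) ℓ) : Set (suc (suc ℓ)) where
    field
      U        : Set ℓ
      V        : Pred (Index → U) ℓ
      ext      : V Respects _≗_
      nonempty : ∃ V
      sub      : Subuniverse (𝔓 V ext) (suc ℓ)
      iso      : A ≅ subalgebra (𝔓 V ext) sub

infixr 7 _·′_
infixr 6 _+′_
infix  8 -′_
data Term (I X : Set ℓ) : Set ℓ where
  var       : X → Term I X
  _·′_ _+′_ : Term I X → Term I X → Term I X
  -′_       : Term I X → Term I X
  0′ 1′     : Term I X
  cyl′      : I → Term I X → Term I X

module _ {I X : Set ℓ} (A : Algebra I c e) where
  open Algebra A

  ⟦_⟧ : Term I X → (X → Carrier) → Carrier
  ⟦ var x ⟧    ρ = ρ x
  ⟦ s ·′ t ⟧   ρ = ⟦ s ⟧ ρ · ⟦ t ⟧ ρ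
  ⟦ s +′ t ⟧   ρ = ⟦ s ⟧ ρ + ⟦ t ⟧ ρ
  ⟦ -′ t ⟧     ρ = - ⟦ t ⟧ ρ
  ⟦ 0′ ⟧       ρ = 0#
  ⟦ 1′ ⟧       ρ = 1#
  ⟦ cyl′ k t ⟧ ρ = cyl k (⟦ t ⟧ ρ)

  Satisfies : Rel (Term I X) (ℓ ⊔ c ⊔ e)
  Satisfies s t = ∀ ρ → ⟦ s ⟧ ρ ≈ ⟦ t ⟧ ρ

module _ (X : Set ℓ) (α : Ordinal ℓ) where
  open Ordinal α using (Index)
  open Algebra

  Valid : Rel (Term Index X) (suc (suc ℓ))
  Valid s t = ∀ A → Drs α A → Satisfies A s t

  𝔉𝔯Drs : Algebra Index ℓ (suc (suc ℓ))
  𝔉𝔯Drs = record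
    { Carrier       = Term Index X
    ; _≈_           = Valid
    ; _·_           = _·′_
    ; _+_           = _+′_
    ; -_            = -′_
    ; 0#            = 0′
    ; 1#            = 1′
    ; cyl           = cyl′
    ; isEquivalence = record
      { refl  = λ A _ _ → ≈-refl A
      ; sym   = λ p A d ρ → ≈-sym A (p A d ρ)
      ; trans = λ p q A d ρ → ≈-trans A (p A d ρ) (q A d ρ)
      }
    ; ·-cong        = λ p q A d ρ → ·-cong A (p A d ρ) (q A d ρ)
    ; +-cong        = λ p q A d ρ → +-cong A (p A d ρ) (q A d ρ)
    ; -‿cong        = λ p A d ρ → -‿cong A (p A d ρ)
    ; cyl-cong      = λ k p A d ρ → cyl-cong A k (p A d ρ)
    }

{-# OPTIONS --safe #-}

-- Let t be non-zero, say t holds at f in 𝔓 V, and let n be the nesting depth of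
-- cylindrifications in t.  Multiply V by a staircase: equip every sequence with
-- natural-number tags τ whose entries at two fixed indices a, b satisfy
-- τ b ≤ τ a ≤ τ b + 1.  Since one cylindrification changes τ b by at most 1,
-- the truth of t at a point with τ b = 0 does not depend on the valuation at
-- the points with τ b > n.  Making these far points all satisfy a variable x,
-- or all satisfy -x, gives two models of t.  They are told apart by the term
-- "some point within 2n + 2 rounds of c_a c_b sees only x within n + 1 rounds":
-- in the second model every point sees a far one.  Hence t is not an atom.
-- Without variables, each term denotes ∅ in every 𝔓 V or V in every 𝔓 V.

module Submission where

open import Defs
open import Axiom.ExcludedMiddle using (ExcludedMiddle)
open import Data.Empty using (⊥; ⊥-elim)
open import Data.Fin as Fin using (Fin)
open import Data.Nat as Nat using (ℕ; zero; suc)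
open import Data.Nat.Properties
  using (≤-refl; ≤-reflexive; ≤-trans; n≤1+n; m≤m+n; m≤m⊔n; m≤n⊔m; <⇒≱;
         +-assoc; +-monoˡ-≤; +-monoʳ-≤; +-suc; +-cancelˡ-≤)
open import Data.Product using (_×_; ∃; _,_; proj₁; proj₂)
open import Data.Sum as Sum using (_⊎_; inj₁; inj₂; [_,_])
open import Data.Unit using (⊤; tt)
open import Function.Base using (_∘_; id)
open import Level using (Lift; lift)
open import Relation.Binary using (IsStrictTotalOrder; _Respects_)
open import Relation.Binary.PropositionalEquality
  using (_≡_; _≢_; _≗_; refl; sym; trans; cong; subst; subst₂)
open import Relation.Nullary using (¬_; yes; no; contradiction)
open import Relation.Unary using (Pred; _∈_; _∉_)

open Subset

-- Reduction of validity to full set algebras.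

module _ {ℓ} (α : Ordinal ℓ) where
  open Ordinal α using (Index)

  𝔓-Drs : {U : Set ℓ} (V : Pred (Index → U) ℓ) (ext : V Respects _≗_) →
          ∃ V → Drs α (𝔓 V ext)
  𝔓-Drs V ext V-nonempty = record
    { U        = _
    ; V        = V
    ; ext      = ext
    ; nonempty = V-nonempty
    ; sub      = record
      { Member     = λ _ → Lift _ ⊤
      ; respects   = λ _ _ → lift tt
      ; ·-closed   = λ _ _ → lift tt
      ; +-closed   = λ _ _ → lift tt
      ; -‿closed   = λ _ → lift tt
      ; 0-closed   = lift tt
      ; 1-closed   = lift tt
      ; cyl-closed = λ _ _ → lift tt
      }
    ; iso      = record
      { to        = λ Y → Y , lift tt
      ; cong      = id
      ; bijective = id , λ Y → proj₁ Y , id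
      ; ·-homo    = λ _ _ → id , id
      ; +-homo    = λ _ _ → id , id
      ; -‿homo    = λ _ → id , id
      ; 0-homo    = id , id
      ; 1-homo    = id , id
      ; cyl-homo  = λ _ _ → id , id
      }
    }

  module _ {A : Algebra Index (Level.suc ℓ) ℓ} (d : Drs α A) where
    open Drs d
    open _≅_ iso
    open Algebra (𝔓 V ext)

    represent : Algebra.Carrier A → Carrier
    represent = proj₁ ∘ to

    represent-⟦⟧ : {X : Set ℓ} (ρ : X → Algebra.Carrier A) (t : Term Index X) →
                   represent (⟦ A ⟧ t ρ) ≈ ⟦ 𝔓 V ext ⟧ t (represent ∘ ρ)
    represent-⟦⟧ {X} ρ = go
      where
      lhs rhs : Term Index X → Carrier
      lhs t = represent (⟦ A ⟧ t ρ)
      rhs t = ⟦ 𝔓 V ext ⟧ t (represent ∘ ρ)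

      go : ∀ t → lhs t ≈ rhs t
      go (var x)  = id , id
      go (s ·′ t) =
        ≈-trans {lhs (s ·′ t)} {lhs s · lhs t} {rhs (s ·′ t)}
          (·-homo _ _) (·-cong {lhs s} {rhs s} {lhs t} {rhs t} (go s) (go t))
      go (s +′ t) =
        ≈-trans {lhs (s +′ t)} {lhs s + lhs t} {rhs (s +′ t)}
          (+-homo _ _) (+-cong {lhs s} {rhs s} {lhs t} {rhs t} (go s) (go t))
      go (-′ t)   =
        ≈-trans {lhs (-′ t)} { - lhs t} {rhs (-′ t)}
          (-‿homo _) (-‿cong {lhs t} {rhs t} (go t))
      go 0′       = 0-homo
      go 1′       = 1-homo
      go (cyl′ k t) =
        ≈-trans {lhs (cyl′ k t)} {cyl k (lhs t)} {rhs (cyl′ k t)}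
          (cyl-homo k _) (cyl-cong k {lhs t} {rhs t} (go t))

  module _ {X : Set ℓ} where

    -- The representing isomorphism is injective, and by `represent-⟦⟧` it turns both sides into
    -- values in `𝔓 V` under the transported valuation.
    valid-if-𝔓 : (s t : Term Index X) →
                 (∀ {U : Set ℓ} (V : Pred (Index → U) ℓ) (ext : V Respects _≗_) →
                   Satisfies (𝔓 V ext) s t) →
                 Valid X α s t
    valid-if-𝔓 s t sat A d ρ =
      proj₁ bijective
        (≈-trans {h s} {v s} {h t} (represent-⟦⟧ d ρ s)
          (≈-trans {v s} {v t} {h t} (sat V ext _)
            (≈-sym {h t} {v t} (represent-⟦⟧ d ρ t))))
      where
      open Drs d
      open _≅_ iso
      open Algebra (𝔓 V ext)

      h v : Term Index X → Carrier
      h r = represent d (⟦ A ⟧ r ρ)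
      v r = ⟦ 𝔓 V ext ⟧ r (represent d ∘ ρ)

  module _ {X : Set ℓ} where
    open Algebra (𝔉𝔯Drs X α)

    ·-lowerˡ : ∀ s t → s · t ≤ s
    ·-lowerˡ s t = valid-if-𝔓 ((s · t) · s) (s · t) λ _ _ _ →
      proj₁ , λ (p , q) → (p , q) , p

    0≉1 : ¬ 0# ≈ 1#
    0≉1 0≈1 with proj₂ (0≈1 _ (𝔓-Drs all _ (point , _)) λ _ → Algebra.0# (𝔓 all _))
                       {point} _
      where
      all : Pred (Index → Lift ℓ ⊤) ℓ
      all _ = Lift ℓ ⊤

      point : Index → Lift ℓ ⊤
      point _ = lift tt
    ... | ()

    -- The free algebra without generators.

    module _ (¬X : ¬ X) where

      -- The disjunction stands outside the quantifiers over `V` and `ρ`: the verdict depends on `t`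
      -- alone and so yields a valid equation.
      void-or-full :
        ∀ t → (∀ {U : Set ℓ} (V : Pred (Index → U) ℓ) (ext : V Respects _≗_) ρ {f} →
                f ∉ set (⟦ 𝔓 V ext ⟧ t ρ))
            ⊎ (∀ {U : Set ℓ} (V : Pred (Index → U) ℓ) (ext : V Respects _≗_) ρ {f} →
                f ∈ V → f ∈ set (⟦ 𝔓 V ext ⟧ t ρ))
      void-or-full (var x) = contradiction x ¬X
      void-or-full (s ·′ t) with void-or-full s | void-or-full t
      ... | inj₁ ¬s | _       = inj₁ λ V ext ρ (p , _) → ¬s V ext ρ p
      ... | inj₂ _  | inj₁ ¬t = inj₁ λ V ext ρ (_ , q) → ¬t V ext ρ q
      ... | inj₂ s! | inj₂ t! = inj₂ λ V ext ρ v → s! V ext ρ v , t! V ext ρ v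
      void-or-full (s +′ t) with void-or-full s | void-or-full t
      ... | inj₁ ¬s | inj₁ ¬t = inj₁ λ V ext ρ → [ ¬s V ext ρ , ¬t V ext ρ ]
      ... | inj₁ _  | inj₂ t! = inj₂ λ V ext ρ v → inj₂ (t! V ext ρ v)
      ... | inj₂ s! | _       = inj₂ λ V ext ρ v → inj₁ (s! V ext ρ v)
      void-or-full (-′ t) with void-or-full t
      ... | inj₁ ¬t = inj₂ λ V ext ρ v → v , ¬t V ext ρ
      ... | inj₂ t! = inj₁ λ V ext ρ (v , ¬t) → ¬t (t! V ext ρ v)
      void-or-full 0′ = inj₁ λ _ _ _ ()
      void-or-full 1′ = inj₂ λ _ _ _ v → v
      void-or-full (cyl′ k t) with void-or-full t
      ... | inj₁ ¬t = inj₁ λ V ext ρ (_ , _ , p , _) → ¬t V ext ρ p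
      -- Each point of `V` is its own witness.
      ... | inj₂ t! = inj₂ λ V ext ρ v → v , _ , t! V ext ρ v , λ _ _ → refl

      0-or-1 : ∀ t → t ≈ 0# ⊎ t ≈ 1#
      0-or-1 t = Sum.map
        (λ ¬t → valid-if-𝔓 t 0# λ V ext ρ → (λ p → contradiction p (¬t V ext ρ)) , λ ())
        (λ t! → valid-if-𝔓 t 1# λ V ext ρ → within (⟦ 𝔓 V ext ⟧ t ρ) , t! V ext ρ)
        (void-or-full t)

      nonzero⇒1 : ∀ t → ¬ t ≈ 0# → t ≈ 1#
      nonzero⇒1 t t≉0 = [ (λ t≈0 → contradiction t≈0 t≉0) , id ] (0-or-1 t)

      two-element : TwoElement (𝔉𝔯Drs X α)
      two-element = record
        { to        = to
        ; cong      = λ { {x} refl → ≈-refl {to x} }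
        ; bijective = injective , surjective
        }
        where
        to : Fin 2 → Carrier
        to Fin.zero    = 0#
        to (Fin.suc _) = 1#

        injective : ∀ {x y} → to x ≈ to y → x ≡ y
        injective {Fin.zero}         {Fin.zero}         _   = refl
        injective {Fin.zero}         {Fin.suc Fin.zero} 0≈1 = contradiction 0≈1 0≉1
        injective {Fin.suc Fin.zero} {Fin.zero}         1≈0 =
          contradiction (≈-sym {1#} {0#} 1≈0) 0≉1
        injective {Fin.suc Fin.zero} {Fin.suc Fin.zero} _   = refl

        surjective : ∀ y → ∃ λ x → ∀ {z} → z ≡ x → to z ≈ y
        surjective y with 0-or-1 y
        ... | inj₁ y≈0 = Fin.zero , λ { refl → ≈-sym {y} {0#} y≈0 }
        ... | inj₂ y≈1 = Fin.suc Fin.zero , λ { refl → ≈-sym {y} {1#} y≈1 }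

      atomic : Atomic (𝔉𝔯Drs X α)
      atomic t t≉0 =
        1# , ((0≉1 ∘ ≈-sym {1#} {0#}) , λ y y≉0 _ → nonzero⇒1 y y≉0) ,
        ≈-trans {1# · t} {1# · 1#} {1#} (·-cong {1#} {1#} {t} {1#} (≈-refl {1#}) t≈1)
          (valid-if-𝔓 (1# · 1#) 1# λ _ _ _ → proj₁ , λ v → v , v)
        where
        t≈1 : t ≈ 1#
        t≈1 = nonzero⇒1 t t≉0

  depth : {X : Set ℓ} → Term Index X → ℕ
  depth (var _)    = 0
  depth (s ·′ t)   = depth s Nat.⊔ depth t
  depth (s +′ t)   = depth s Nat.⊔ depth t
  depth (-′ t)     = depth t
  depth 0′         = 0
  depth 1′         = 0
  depth (cyl′ _ t) = suc (depth t)

  -- Separating terms and the staircase.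

  module _ {a b : Index} (a≢b : a ≢ b) where
    open Nat using (_+_; _≤_; _<_; s≤s)

    module _ {X : Set ℓ} where

      somewhere everywhere : ℕ → Term Index X → Term Index X
      somewhere zero    t = t
      somewhere (suc m) t = cyl′ a (cyl′ b (somewhere m t))
      everywhere m t = -′ somewhere m (-′ t)

      -- From height at least 2n + 2, n + 1 rounds cannot get below n + 1; from any point, n + 1
      -- rounds can climb above n. The two counts serve these two facts.
      separator : ℕ → X → Term Index X
      separator n x = somewhere (suc n + suc n) (everywhere (suc n) (var x))

    module Staircase
      {U : Set ℓ} (V : Pred (Index → U) ℓ) (ext : V Respects _≗_) where

      height : (Index → U × ℕ) → ℕ
      height F = proj₂ (F b)

      -- Once one of the tags at `a` and `b` is fixed, the other has at most two possible values;
      -- tags elsewhere are free.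
      V̂ : Pred (Index → U × ℕ) ℓ
      V̂ F = proj₁ ∘ F ∈ V × height F ≤ proj₂ (F a) × proj₂ (F a) ≤ suc (height F)

      ext̂ : V̂ Respects _≗_
      ext̂ {F} {G} F≗G (v , p , q) =
        ext (cong proj₁ ∘ F≗G) v ,
        subst₂ _≤_ (tag b) (tag a) p ,
        subst₂ _≤_ (tag a) (cong suc (tag b)) q
        where
        tag : ∀ k → proj₂ (F k) ≡ proj₂ (G k)
        tag = cong proj₂ ∘ F≗G

      open IsStrictTotalOrder (Ordinal.isStrictTotalOrder α) using (_≟_)

      -- A change away from `b` keeps the height. A change at `b` keeps the tag at `a`, which is at
      -- least the height of `F` and at most one more than that of `G`.
      height-step : ∀ {F G k} → F ∈ V̂ → G ∈ V̂ → F ≡[ k ] G →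
                    height F ≤ suc (height G)
      height-step {F} {G} {k} (_ , F≤ , _) (_ , _ , ≤G) F≡G with b ≟ k
      ... | yes refl = ≤-trans F≤ (subst (_≤ suc (height G))
                         (sym (cong proj₂ (F≡G a a≢b))) ≤G)
      ... | no  b≢k  = ≤-trans (≤-reflexive (cong proj₂ (F≡G b b≢k))) (n≤1+n _)

      _[_≔_] : (Index → U × ℕ) → Index → ℕ → Index → U × ℕ
      (F [ k ≔ m ]) j with j ≟ k
      ... | yes _ = proj₁ (F j) , m
      ... | no  _ = F j

      ≔-same : ∀ F k m → proj₂ ((F [ k ≔ m ]) k) ≡ m
      ≔-same F k m with k ≟ k
      ... | yes _  = refl
      ... | no k≢k = contradiction refl k≢k

      ≔-other : ∀ F k m → F ≡[ k ] F [ k ≔ m ]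
      ≔-other F k m j j≢k with j ≟ k
      ... | yes j≡k = contradiction j≡k j≢k
      ... | no  _   = refl

      ≔-proj₁ : ∀ F k m → proj₁ ∘ F ≗ proj₁ ∘ F [ k ≔ m ]
      ≔-proj₁ F k m j with j ≟ k
      ... | yes _ = refl
      ... | no  _ = refl

      -- The tag at `a` moves first: when both tags are equal, raising the one at `b` would leave
      -- `V̂`. If the tag at `a` is already one higher, the first move changes nothing.
      stair : ∀ {F} → F ∈ V̂ →
              ∃ λ F′ → ∃ λ G → F′ ∈ V̂ × G ∈ V̂ ×
                F ≡[ a ] F′ × F′ ≡[ b ] G × height G ≡ suc (height F)
      stair {F} (v , p , q) =
        F′ , G ,
        (v′ , subst₂ _≤_ F′b (sym F′a) (n≤1+n _) ,
              subst₂ _≤_ (sym F′a) (cong suc F′b) ≤-refl) ,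
        (ext (≔-proj₁ F′ b h) v′ , subst₂ _≤_ (sym Gb) (sym Ga) ≤-refl ,
              subst₂ _≤_ (sym Ga) (cong suc (sym Gb)) (n≤1+n _)) ,
        ≔-other F a h , ≔-other F′ b h , Gb
        where
        h : ℕ
        h = suc (height F)

        F′ G : Index → U × ℕ
        F′ = F [ a ≔ h ]
        G  = F′ [ b ≔ h ]

        v′ : proj₁ ∘ F′ ∈ V
        v′ = ext (≔-proj₁ F a h) v

        F′a : proj₂ (F′ a) ≡ h
        F′a = ≔-same F a h

        F′b : height F ≡ height F′
        F′b = cong proj₂ (≔-other F a h b (a≢b ∘ sym))

        Gb : height G ≡ h
        Gb = ≔-same F′ b h

        Ga : proj₂ (G a) ≡ h
        Ga = trans (sym (cong proj₂ (≔-other F′ b h a a≢b))) F′a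

      module _ {X : Set ℓ} (σ : X → Subset V̂) where

        ⟦_⟧̂ : Term Index X → Pred (Index → U × ℕ) ℓ
        ⟦ t ⟧̂ = set (⟦ 𝔓 V̂ ext̂ ⟧ t σ)

        -- Iterates `stair`. The endpoint is chosen before `t`, so its height is available when `t`
        -- is verified there.
        climb : ∀ m {F} → F ∈ V̂ →
                ∃ λ G → G ∈ V̂ × height G ≡ m + height F ×
                  (∀ t → G ∈ ⟦ t ⟧̂ → F ∈ ⟦ somewhere m t ⟧̂)
        climb zero    {F} F∈ = F , F∈ , refl , λ _ → id
        climb (suc m) {F} F∈ =
          let F′ , G , F′∈ , G∈ , F≡F′ , F′≡G , G-height = stair F∈
              H , H∈ , H-height , lift-t = climb m G∈
          in H , H∈ ,
             trans H-height (trans (cong (m +_) G-height) (+-suc m (height F))) ,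
             λ t t∈ → F∈ , F′ , (F′∈ , G , lift-t t t∈ , F′≡G) , F≡F′

        -- Each round loses at most one level: the move at `a` keeps the height, and `height-step`
        -- bounds the move at `b`.
        descend : ∀ m t {F} → F ∈ ⟦ somewhere m t ⟧̂ →
                  ∃ λ G → G ∈ ⟦ t ⟧̂ × height F ≤ m + height G
        descend zero    t {F} t∈ = F , t∈ , ≤-refl
        descend (suc m) t {F} (_ , F′ , (F′∈ , G , G∈ , F′≡G) , F≡F′) =
          let H , H∈ , G≤H = descend m t G∈
          in H , H∈ ,
             ≤-trans (≤-reflexive (cong proj₂ (F≡F′ b (a≢b ∘ sym))))
               (≤-trans
                 (height-step F′∈ (within (⟦ 𝔓 V̂ ext̂ ⟧ (somewhere m t) σ) G∈) F′≡G)
                 (s≤s G≤H))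

      -- Changing the valuation at far points.

      module _ {X : Set ℓ} (ρ : X → Subset V) (n : ℕ) where

        -- `B` is the truth value of all variables above height `n`: `⊤` includes every far point,
        -- `⊥` excludes every one.
        override : Set → X → Subset V̂
        override B y = record
          { set      = λ F → F ∈ V̂ × (height F ≤ n → proj₁ ∘ F ∈ set (ρ y))
                               × (n < height F → B)
          ; respects = λ F≗G (F∈ , near , far) →
              let eq = cong proj₂ (sym (F≗G b))
              in ext̂ F≗G F∈ ,
                 (λ le → respects (ρ y) (cong proj₁ ∘ F≗G)
                           (near (subst (_≤ n) eq le))) ,
                 (λ lt → far (subst (n <_) eq lt))
          ; within   = proj₁
          }

        module _ (B : Set) where

          ⟦_⟧ᵛ : Term Index X → Pred (Index → U) ℓ
          ⟦ t ⟧ᵛ = set (⟦ 𝔓 V ext ⟧ t ρ)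

          ⟦_⟧ᵒ : Term Index X → Pred (Index → U × ℕ) ℓ
          ⟦ t ⟧ᵒ = set (⟦ 𝔓 V̂ ext̂ ⟧ t (override B))

          -- A cylindrification spends one unit of depth and raises the height by at most one, so
          -- the bound survives and variables are read only at near points. Complement swaps the two
          -- directions, hence the joint induction.
          local : ∀ t {F} → F ∈ V̂ → height F + depth t ≤ n →
                  (F ∈ ⟦ t ⟧ᵒ → proj₁ ∘ F ∈ ⟦ t ⟧ᵛ)
                  × (proj₁ ∘ F ∈ ⟦ t ⟧ᵛ → F ∈ ⟦ t ⟧ᵒ)
          local (var x) {F} F∈ le =
            (λ (_ , near , _) → near h≤n) ,
            (λ p → F∈ , (λ _ → p) , λ lt → contradiction h≤n (<⇒≱ lt))
            where
            h≤n : height F ≤ n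
            h≤n = ≤-trans (m≤m+n (height F) 0) le
          local (s ·′ t) {F} F∈ le =
            let s→ , s← = local s F∈ (≤-trans (+-monoʳ-≤ (height F) (m≤m⊔n _ _)) le)
                t→ , t← = local t F∈
                  (≤-trans (+-monoʳ-≤ (height F) (m≤n⊔m (depth s) _)) le)
            in (λ (p , q) → s→ p , t→ q) , λ (p , q) → s← p , t← q
          local (s +′ t) {F} F∈ le =
            let s→ , s← = local s F∈ (≤-trans (+-monoʳ-≤ (height F) (m≤m⊔n _ _)) le)
                t→ , t← = local t F∈
                  (≤-trans (+-monoʳ-≤ (height F) (m≤n⊔m (depth s) _)) le)
            in Sum.map s→ t→ , Sum.map s← t←
          local (-′ t) F∈ le =
            let t→ , t← = local t F∈ le
            in (λ (_ , ¬t) → proj₁ F∈ , ¬t ∘ t←) , λ (_ , ¬t) → F∈ , ¬t ∘ t→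
          local 0′ _ _ = (λ ()) , λ ()
          local 1′ F∈ _ = (λ _ → proj₁ F∈) , λ _ → F∈
          local (cyl′ k t) {F} F∈ le =
            (λ (_ , G , G∈t , F≡G) →
              let G∈ = within (⟦ 𝔓 V̂ ext̂ ⟧ t (override B)) G∈t
              in proj₁ F∈ , proj₁ ∘ G ,
                 proj₁ (local t G∈ (closer G∈ λ j j≢k → sym (F≡G j j≢k))) G∈t ,
                 λ j j≢k → cong proj₁ (F≡G j j≢k)) ,
            (λ (_ , g , g∈t , f≡g) →
              -- Keeping the tags of `F` puts the lifted witness in `V̂` and preserves agreement off
              -- `k`.
              let G  = λ j → g j , proj₂ (F j)
                  G∈ = within (⟦ 𝔓 V ext ⟧ t ρ) g∈t , proj₂ F∈
                  F≡G : F ≡[ k ] G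
                  F≡G = λ j j≢k → cong (_, proj₂ (F j)) (f≡g j j≢k)
              in F∈ , G ,
                 proj₂ (local t G∈ (closer G∈ λ j j≢k → sym (F≡G j j≢k))) g∈t ,
                 F≡G)
            where
            closer : ∀ {G} → G ∈ V̂ → G ≡[ k ] F → height G + depth t ≤ n
            closer {G} G∈ G≡F =
              ≤-trans (+-monoˡ-≤ (depth t) (height-step G∈ F∈ G≡F))
                (subst (_≤ n) (+-suc (height F) (depth t)) le)

        separator-⊤ : ∀ x {F} → F ∈ V̂ → F ∈ ⟦_⟧ᵒ ⊤ (separator n x)
        separator-⊤ x {F} F∈ =
          let G , G∈ , G-height , lift-t = climb (override ⊤) (suc n + suc n) F∈
          in lift-t (everywhere (suc n) (var x)) (G∈ , λ p →
            let H , (H∈ , H∉x) , G≤H = descend (override ⊤) (suc n) (-′ var x) p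
                -- Cancel n + 1 in 2n + 2 + `height F` = `height G` ≤ n + 1 + `height H`.
                n<H : n < height H
                n<H = ≤-trans (m≤m+n (suc n) (height F)) (+-cancelˡ-≤ (suc n) _ _
                  (≤-trans (≤-reflexive (trans
                     (sym (+-assoc (suc n) (suc n) (height F))) (sym G-height))) G≤H))
            in H∉x (H∈ , (λ le → contradiction le (<⇒≱ n<H)) , _))

        -- Whatever point the outer rounds reach, n + 1 further climbs lead to a far point, where
        -- `x` fails.
        separator-⊥ : ∀ x {F} → F ∉ ⟦_⟧ᵒ ⊥ (separator n x)
        separator-⊥ x F∈sep =
          let G , (G∈ , G∉) , _ =
                descend (override ⊥) (suc n + suc n) (everywhere (suc n) (var x)) F∈sep
              H , H∈ , H-height , lift-t = climb (override ⊥) (suc n) G∈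
          in G∉ (lift-t (-′ var x) (H∈ , λ (_ , _ , far) →
               far (≤-trans (m≤m+n (suc n) (height G)) (≤-reflexive (sym H-height)))))

    -- No atoms over a generator.

    module _ {X : Set ℓ} (x : X) where
      open Algebra (𝔉𝔯Drs X α)

      atomless : Atomless (𝔉𝔯Drs X α)
      -- No model is extracted from `t≉0`; instead every supposed point of `t` is refuted, which
      -- makes `t` zero.
      atomless t (t≉0 , minimal) = t≉0 (valid-if-𝔓 t 0# λ V ext ρ →
        (λ {f} f∈t → ⊥-elim (refute V ext ρ f f∈t)) , λ ())
        where
        s : Term Index X
        s = separator (depth t) x

        refute : ∀ {U : Set ℓ} (V : Pred (Index → U) ℓ) (ext : V Respects _≗_)
                 (ρ : X → Subset V) f → f ∉ set (⟦ 𝔓 V ext ⟧ t ρ)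
        refute {U} V ext ρ f f∈t =
          -- Minimality makes `t` imply `s`, contradicted at the root when far points fail all
          -- variables.
          separator-⊥ ρ n x (proj₂ (proj₂ (t·s≈t _ drs (override ρ n ⊥)) (root∈t ⊥)))
          where
          open Staircase V ext

          n : ℕ
          n = depth t

          -- Height 0 leaves the whole bound `n` for the depth of `t`.
          root : Index → U × ℕ
          root j = f j , 0

          root∈V̂ : root ∈ V̂
          root∈V̂ = within (⟦ 𝔓 V ext ⟧ t ρ) f∈t , Nat.z≤n , Nat.z≤n

          drs : Drs α (𝔓 V̂ ext̂)
          drs = 𝔓-Drs V̂ ext̂ (root , root∈V̂)

          root∈t : ∀ B → root ∈ set (⟦ 𝔓 V̂ ext̂ ⟧ t (override ρ n B))
          root∈t B = proj₂ (local ρ n B t root∈V̂ ≤-refl) f∈t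

          t·s≉0 : ¬ t · s ≈ 0#
          t·s≉0 t·s≈0
            with proj₁ (t·s≈0 _ drs (override ρ n ⊤))
                   (root∈t ⊤ , separator-⊤ ρ n x root∈V̂)
          ... | ()

          t·s≈t : t · s ≈ t
          t·s≈t = minimal (t · s) t·s≉0 (·-lowerˡ t s)

theorem2 : (∀ {p} → ExcludedMiddle p) →
    ∀ {ℓ} (α : Ordinal ℓ) → finite 2 ≤ₒ α → (X : Set ℓ) →
    (¬ X → TwoElement (𝔉𝔯Drs X α) × Atomic (𝔉𝔯Drs X α))
    × (¬ ¬ X → Atomless (𝔉𝔯Drs X α))
theorem2 _ α (ι , ι-mono , _) X =
  (λ ¬X → two-element α ¬X , atomic α ¬X) ,
  -- The goal is a negation, so a generator may be assumed.
  (λ ¬¬X t t-atom → ¬¬X λ x → atomless α ι₀≢ι₁ x t t-atom)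
  where
  open Ordinal α
  open IsStrictTotalOrder isStrictTotalOrder using (irrefl)

  ι₀≢ι₁ : ι Fin.zero ≢ ι (Fin.suc Fin.zero)
  ι₀≢ι₁ eq = irrefl eq (ι-mono (Nat.s≤s Nat.z≤n))
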